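{- Let $R$ be a principal ideal domain and let $I=gR\subsetneq R$ be a proper, non-prime ideal such that $Q:=R/I$ is finite. Suppose that $g$ has exactly one prime factor up to association, i.e. $g=u\cdot p_1^{m_1}$ with $u$ a unit, $p_1$ a prime element and $m_1\ge 1$ an integer. Then the reduced zero divisor graph $\Gamma_E(Q)$ satisfies \[\dim_{TH}(\Gamma_E(Q))=\mathrm{box}(\Gamma_E(Q))=\begin{cases}0 & \text{if } m_1\le 3,\\ 1 & \text{if } m_1\ge 4.\end{cases}\]
   Context: Rings are commutative and non-zero with $1$. For a ring $Q$, $Z(Q)$ is the set of $r\in Q$ for which there is $s\in Q\setminus\{0\}$ with $rs=0$. The zero divisor graph $\Gamma(Q)$ has vertex set $Z(Q)\setminus\{0\}$; two distinct vertices $r,s$ are adjacent iff $rs=0$. For a graph $G=(V,E)$ write $u\sim v$ if $u$ and $v$ have the same set of neighbours; the reduced graph $G_E$ has as vertices the equivalence classes $[v]$ of $\sim$ and edges $\{[u],[v]\}$ for $\{u,v\}\in E$. $\Gamma_E(Q)$ is the reduced graph of $\Gamma(Q)$. The boxicity $\mathrm{box}(G)$ of a finite simple graph $G$ is the minimum integer $d\ge 0$ such that there exist $d$ interval graphs $I_1,\dots,I_d$ on $V(G)$ with $E(G)=\bigcap_{j=1}^d E(I_j)$. For a finite set $V$, $\alpha\colon V\to\mathbb{R}$ and $S\in\mathbb{R}$, the threshold graph $T(\alpha,S)$ has vertex set $V$ and edges all $\{v,w\}$, $v\neq w$, with $\alpha(v)+\alpha(w)\ge S$; a graph is a threshold graph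 if it is of this form. The threshold dimension $\dim_{TH}(G)$ is the minimum $d\ge 0$ such that there exist $d$ threshold graphs $H_1,\dots,H_d$ on $V(G)$ with $E(G)=\bigcap_{j=1}^d E(H_j)$. In both definitions the empty intersection ($d=0$) is the set of all pairs of vertices, so the parameter is $0$ exactly for complete graphs (including the graph with no vertices). -}

module Defs where

open import Algebra.Bundles using (CommutativeMonoid; CommutativeRing)
import Algebra.Properties.AbelianGroup as AbelianGroupProperties
import Algebra.Properties.Ring as RingProperties
import Algebra.Properties.Semiring.Divisibility as SemiringDivisibility
import Algebra.Properties.CommutativeSemigroup as CommutativeSemigroupProperties
open import Data.Fin.Base using (Fin)
open import Data.Nat.Base as ℕ using (ℕ)
import Data.Nat.Properties as ℕ
open import Data.Product.Base using (Σ; ∃₂; ∃-syntax; _×_; _,_; proj₁)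
open import Data.Rational.Base as ℚ using (ℚ; 0ℚ; ½; ∣_∣)
import Data.Rational.Properties as ℚ
open import Data.Sum.Base using (_⊎_)
open import Function.Bundles using (Func; Inverse; _⟨$⟩_; _⇔_; mk⇔; Equivalence)
open import Level using (Level; _⊔_; suc; 0ℓ)
open import Relation.Binary.Bundles using (Setoid)
open import Relation.Binary.Core using (Rel)
open import Relation.Binary.Definitions
  using (Reflexive; Symmetric; Transitive; Irreflexive; _Respects₂_)
import Relation.Binary.Construct.On as On
open import Relation.Binary.PropositionalEquality as ≡ using (_≡_)
import Relation.Binary.Reasoning.Setoid as ≈-Reasoning
open import Relation.Nullary.Negation.Core using (¬_)
open import Relation.Unary using (Pred)

private
  variable
    c e ℓ : Level

private
  half-pos : ∀ {ε} → 0ℚ ℚ.< ε → 0ℚ ℚ.< ½ ℚ.* ε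
  half-pos {ε} ε>0 = ≡.subst (ℚ._< ½ ℚ.* ε) (ℚ.*-zeroʳ ½) (ℚ.*-monoʳ-<-pos ½ ε>0)

  halves : ∀ ε → ½ ℚ.* ε ℚ.+ ½ ℚ.* ε ≡ ε
  halves ε = ≡.trans (≡.sym (ℚ.*-distribʳ-+ ε ½ ½)) (ℚ.*-identityˡ ε)

  module ℚ+ = CommutativeSemigroupProperties
    (CommutativeMonoid.commutativeSemigroup ℚ.+-0-commutativeMonoid)

-- Cauchy sequences of rationals; the quotient by null sequences is the setoid
-- equality _≈ᵣ_, given as _≤ᵣ_ in both directions.
record ℝ : Set where
  field
    seq    : ℕ → ℚ
    cauchy : ∀ ε → 0ℚ ℚ.< ε →
             ∃[ N ] ∀ m n → N ℕ.≤ m → N ℕ.≤ n → ∣ seq m ℚ.- seq n ∣ ℚ.< ε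

open ℝ

infix  4 _≤ᵣ_ _≈ᵣ_
infixl 6 _+ᵣ_

_≤ᵣ_ : Rel ℝ 0ℓ
x ≤ᵣ y = ∀ ε → 0ℚ ℚ.< ε → ∃[ N ] ∀ n → N ℕ.≤ n → seq x n ℚ.≤ seq y n ℚ.+ ε

_≈ᵣ_ : Rel ℝ 0ℓ
x ≈ᵣ y = x ≤ᵣ y × y ≤ᵣ x

≤ᵣ-refl : Reflexive _≤ᵣ_
≤ᵣ-refl {x} ε ε>0 = 0 , λ n _ →
  ≡.subst (ℚ._≤ seq x n ℚ.+ ε) (ℚ.+-identityʳ (seq x n))
    (ℚ.+-monoʳ-≤ (seq x n) (ℚ.<⇒≤ ε>0))

≤ᵣ-trans : Transitive _≤ᵣ_
≤ᵣ-trans {x} {y} {z} x≤y y≤z ε ε>0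
  with x≤y (½ ℚ.* ε) (half-pos ε>0) | y≤z (½ ℚ.* ε) (half-pos ε>0)
... | N , x≤y′ | M , y≤z′ = N ℕ.⊔ M , λ n N⊔M≤n → begin
  seq x n                                ≤⟨ x≤y′ n (ℕ.≤-trans (ℕ.m≤m⊔n N M) N⊔M≤n) ⟩
  seq y n ℚ.+ ½ ℚ.* ε                    ≤⟨ ℚ.+-monoˡ-≤ (½ ℚ.* ε) (y≤z′ n (ℕ.≤-trans (ℕ.m≤n⊔m N M) N⊔M≤n)) ⟩
  (seq z n ℚ.+ ½ ℚ.* ε) ℚ.+ ½ ℚ.* ε      ≡⟨ ℚ.+-assoc (seq z n) _ _ ⟩
  seq z n ℚ.+ (½ ℚ.* ε ℚ.+ ½ ℚ.* ε)      ≡⟨ ≡.cong (seq z n ℚ.+_) (halves ε) ⟩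
  seq z n ℚ.+ ε                          ∎
  where open ℚ.≤-Reasoning

ℝ-setoid : Setoid 0ℓ 0ℓ
ℝ-setoid = record
  { Carrier       = ℝ
  ; _≈_           = _≈ᵣ_
  ; isEquivalence = record
    { refl  = λ {x} → ≤ᵣ-refl {x} , ≤ᵣ-refl {x}
    ; sym   = λ (p , q) → q , p
    ; trans = λ {x} {y} {z} (p , q) (r , s) →
        ≤ᵣ-trans {x} {y} {z} p r , ≤ᵣ-trans {z} {y} {x} s q
    }
  }

_+ᵣ_ : ℝ → ℝ → ℝ
seq    (x +ᵣ y) n = seq x n ℚ.+ seq y n
cauchy (x +ᵣ y) ε ε>0
  with cauchy x (½ ℚ.* ε) (half-pos ε>0) | cauchy y (½ ℚ.* ε) (half-pos ε>0)
... | N , xc | M , yc = N ℕ.⊔ M , λ m n N⊔M≤m N⊔M≤n →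
  let x-close = xc m n (ℕ.≤-trans (ℕ.m≤m⊔n N M) N⊔M≤m) (ℕ.≤-trans (ℕ.m≤m⊔n N M) N⊔M≤n)
      y-close = yc m n (ℕ.≤-trans (ℕ.m≤n⊔m N M) N⊔M≤m) (ℕ.≤-trans (ℕ.m≤n⊔m N M) N⊔M≤n)
      xm = seq x m ; xn = seq x n ; ym = seq y m ; yn = seq y n
  in begin-strict
  ∣ (xm ℚ.+ ym) ℚ.- (xn ℚ.+ yn) ∣        ≡⟨ ≡.cong (λ q → ∣ (xm ℚ.+ ym) ℚ.+ q ∣) (ℚ.neg-distrib-+ xn yn) ⟩
  ∣ (xm ℚ.+ ym) ℚ.+ (ℚ.- xn ℚ.- yn) ∣    ≡⟨ ≡.cong ∣_∣ (ℚ+.interchange xm ym (ℚ.- xn) (ℚ.- yn)) ⟩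
  ∣ (xm ℚ.- xn) ℚ.+ (ym ℚ.- yn) ∣        ≤⟨ ℚ.∣p+q∣≤∣p∣+∣q∣ (xm ℚ.- xn) (ym ℚ.- yn) ⟩
  ∣ xm ℚ.- xn ∣ ℚ.+ ∣ ym ℚ.- yn ∣        <⟨ ℚ.+-mono-< x-close y-close ⟩
  ½ ℚ.* ε ℚ.+ ½ ℚ.* ε                    ≡⟨ halves ε ⟩
  ε                                      ∎
  where open ℚ.≤-Reasoning

record GraphOn (V : Setoid c e) : Set (c ⊔ suc e) where
  open Setoid V using (_≈_) renaming (Carrier to Vertex)
  field
    Adj        : Rel Vertex e
    adj-resp   : Adj Respects₂ _≈_
    adj-sym    : Symmetric Adj
    adj-irrefl : Irreflexive _≈_ Adj

open GraphOn

module _ {V : Setoid c e} where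
  open Setoid V using (_≈_; _≉_) renaming (Carrier to Vertex)

  -- Every vertex gets a non-empty closed interval; adjacency of distinct
  -- vertices is having a point in common.
  record IsIntervalGraph (G : GraphOn V) : Set (c ⊔ e) where
    field
      lo hi : Func V ℝ-setoid
      lo≤hi : ∀ v → lo ⟨$⟩ v ≤ᵣ hi ⟨$⟩ v

    _∈[_] : ℝ → Vertex → Set
    x ∈[ v ] = lo ⟨$⟩ v ≤ᵣ x × x ≤ᵣ hi ⟨$⟩ v

    field
      adj⇔meet : ∀ v w → v ≉ w → Adj G v w ⇔ (∃[ x ] (x ∈[ v ] × x ∈[ w ]))

  record IsThresholdGraph (G : GraphOn V) : Set (c ⊔ e) where
    field
      α         : Func V ℝ-setoid
      S         : ℝ
      adj⇔S≤α+α : ∀ v w → v ≉ w → Adj G v w ⇔ (S ≤ᵣ (α ⟨$⟩ v) +ᵣ (α ⟨$⟩ w))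

  -- E(G) = ⋂ⱼ E(Hⱼ).  As only pairs of distinct vertices are compared, the
  -- empty intersection is the edge set of the complete graph.
  EdgesAreIntersection : GraphOn V → ∀ {d} → (Fin d → GraphOn V) → Set (c ⊔ e)
  EdgesAreIntersection G H = ∀ v w → v ≉ w → Adj G v w ⇔ (∀ j → Adj (H j) v w)

  IntersectionOf : ∀ {p} → Pred (GraphOn V) p → GraphOn V → ℕ → Set (c ⊔ suc e ⊔ p)
  IntersectionOf P G d =
    Σ (Fin d → GraphOn V) λ H → (∀ j → P (H j)) × EdgesAreIntersection G H

IsMinimum : ∀ {p} → Pred ℕ p → Pred ℕ p
IsMinimum P d = P d × (∀ d′ → P d′ → d ℕ.≤ d′)

-- IsBoxicity G d and IsThresholdDimension G d express box(G) = d and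
-- dim_TH(G) = d.
IsBoxicity : {V : Setoid c e} → GraphOn V → ℕ → Set (c ⊔ suc e)
IsBoxicity G = IsMinimum (IntersectionOf IsIntervalGraph G)

IsThresholdDimension : {V : Setoid c e} → GraphOn V → ℕ → Set (c ⊔ suc e)
IsThresholdDimension G = IsMinimum (IntersectionOf IsThresholdGraph G)

module _ {V : Setoid c e} (G : GraphOn V) where
  open Setoid V using () renaming (Carrier to Vertex)
  open Equivalence

  SameNeighbours : Rel Vertex (c ⊔ e)
  SameNeighbours u v = ∀ w → Adj G u w ⇔ Adj G v w

  -- The quotient of V by SameNeighbours, so a vertex u stands for [u].
  reducedVertices : Setoid c (c ⊔ e)
  reducedVertices = record
    { Carrier       = Vertex
    ; _≈_           = SameNeighbours
    ; isEquivalence = record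
      { refl  = λ w → mk⇔ (λ a → a) (λ a → a)
      ; sym   = λ p w → mk⇔ (from (p w)) (to (p w))
      ; trans = λ p q w → mk⇔ (λ a → to (q w) (to (p w) a))
                              (λ a → from (p w) (from (q w) a))
      }
    }

  private module ~ = Setoid reducedVertices

  reducedGraph : GraphOn reducedVertices
  reducedGraph = record
    { Adj        = λ u v → ∃₂ λ u′ v′ →
                     SameNeighbours u′ u × SameNeighbours v′ v × Adj G u′ v′
    ; adj-resp   =
        (λ v~w (u′ , v′ , u′~u , v′~v , a) →
           u′ , v′ , u′~u , ~.trans {v′} v′~v v~w , a)
      , (λ u~w (u′ , v′ , u′~u , v′~v , a) →
           u′ , v′ , ~.trans {u′} u′~u u~w , v′~v , a)
    ; adj-sym    = λ (u′ , v′ , u′~u , v′~v , a) → v′ , u′ , v′~v , u′~u , adj-sym G a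
    ; adj-irrefl = λ u~v (u′ , v′ , u′~u , v′~v , a) →
        adj-irrefl G (Setoid.refl V)
          (from (v′~v v′) (to (u~v v′) (to (u′~u v′) a)))
    }

module _ (Q : CommutativeRing c ℓ) where
  open CommutativeRing Q

  IsZeroDivisor : Pred Carrier (c ⊔ ℓ)
  IsZeroDivisor r = ∃[ s ] (s ≉ 0# × r * s ≈ 0#)

  zeroDivisorVertices : Setoid (c ⊔ ℓ) ℓ
  zeroDivisorVertices =
    On.setoid {B = ∃[ r ] (IsZeroDivisor r × r ≉ 0#)} setoid proj₁

  zeroDivisorGraph : GraphOn zeroDivisorVertices
  zeroDivisorGraph = record
    { Adj        = λ (r , _) (s , _) → r ≉ s × r * s ≈ 0#
    ; adj-resp   =
        (λ s≈t (r≉s , rs≈0) →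
           (λ r≈t → r≉s (trans r≈t (sym s≈t))) , trans (*-congˡ (sym s≈t)) rs≈0)
      , (λ s≈t (s≉r , sr≈0) →
           (λ t≈r → s≉r (trans s≈t t≈r)) , trans (*-congʳ (sym s≈t)) sr≈0)
    ; adj-sym    = λ {(r , _)} {(s , _)} (r≉s , rs≈0) →
                     (λ s≈r → r≉s (sym s≈r)) , trans (*-comm s r) rs≈0
    ; adj-irrefl = λ r≈s (r≉s , _) → r≉s r≈s
    }

  reducedZeroDivisorGraph : GraphOn (reducedVertices zeroDivisorGraph)
  reducedZeroDivisorGraph = reducedGraph zeroDivisorGraph

IsFinite : Setoid c ℓ → Set (c ⊔ ℓ)
IsFinite A = ∃[ n ] Inverse A (≡.setoid (Fin n))

module _ (R : CommutativeRing c ℓ) where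
  open CommutativeRing R
  open SemiringDivisibility semiring using (_∣_; _,_)

  IsUnit : Pred Carrier (c ⊔ ℓ)
  IsUnit u = u ∣ 1#

  -- The level of membership is that of the principal ideals below.
  record Ideal : Set (suc (c ⊔ ℓ)) where
    field
      Member   : Pred Carrier (c ⊔ ℓ)
      resp     : ∀ {x y} → x ≈ y → Member x → Member y
      0∈       : Member 0#
      +-closed : ∀ {x y} → Member x → Member y → Member (x + y)
      *-closed : ∀ r {x} → Member x → Member (r * x)

  open Ideal

  IsProper : Pred Ideal (c ⊔ ℓ)
  IsProper I = ∃[ x ] ¬ Member I x

  IsPrimeIdeal : Pred Ideal (c ⊔ ℓ)
  IsPrimeIdeal I = IsProper I × (∀ x y → Member I (x * y) → Member I x ⊎ Member I y)

  -- gR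
  principalIdeal : Carrier → Ideal
  principalIdeal g = record
    { Member   = g ∣_
    ; resp     = λ x≈y (r , rg≈x) → r , trans rg≈x x≈y
    ; 0∈       = 0# , zeroˡ g
    ; +-closed = λ (r , rg≈x) (s , sg≈y) →
                   r + s , trans (distribʳ g r s) (+-cong rg≈x sg≈y)
    ; *-closed = λ t (r , rg≈x) → t * r , trans (*-assoc t r g) (*-congˡ rg≈x)
    }

  record IsPrincipalIdealDomain : Set (suc (c ⊔ ℓ)) where
    field
      1≉0           : 1# ≉ 0#
      noZeroDivisor : ∀ x y → x * y ≈ 0# → x ≈ 0# ⊎ y ≈ 0#
      -- Ideals are arbitrary predicates, not only decidable ones: this is the
      -- classical notion, with ordinary examples only under excluded middle.
      principal     : ∀ I → ∃[ a ] (∀ x → Member I x ⇔ Member (principalIdeal a) x)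

  module _ (I : Ideal) where
    private
      module G = AbelianGroupProperties +-abelianGroup
      module R = RingProperties ring
      module S = CommutativeSemigroupProperties +-commutativeSemigroup

      infix 4 _≈ᴵ_
      _≈ᴵ_ : Rel Carrier (c ⊔ ℓ)
      x ≈ᴵ y = Member I (x - y)

      ≈⇒≈ᴵ : ∀ {x y} → x ≈ y → x ≈ᴵ y
      ≈⇒≈ᴵ x≈y = resp I (sym (G.x≈y⇒x∙y⁻¹≈ε x≈y)) (0∈ I)

      symᴵ : Symmetric _≈ᴵ_
      symᴵ {x} {y} x-y∈I =
        resp I (trans (R.-1*x≈-x (x - y)) (G.⁻¹-anti-homo‿- x y)) (*-closed I (- 1#) x-y∈I)

      open ≈-Reasoning setoid

      transᴵ : Transitive _≈ᴵ_
      transᴵ {x} {y} {z} x-y∈I y-z∈I = resp I eq (+-closed I x-y∈I y-z∈I)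
        where
        eq : (x - y) + (y - z) ≈ x - z
        eq = begin
          (x - y) + (y - z)      ≈⟨ +-assoc x (- y) (y - z) ⟩
          x + (- y + (y - z))    ≈⟨ +-congˡ (+-assoc (- y) y (- z)) ⟨
          x + ((- y + y) - z)    ≈⟨ +-congˡ (+-congʳ (-‿inverseˡ y)) ⟩
          x + (0# - z)           ≈⟨ +-congˡ (+-identityˡ (- z)) ⟩
          x - z                  ∎

      +-congᴵ : ∀ {x y u v} → x ≈ᴵ y → u ≈ᴵ v → x + u ≈ᴵ y + v
      +-congᴵ {x} {y} {u} {v} x-y∈I u-v∈I = resp I eq (+-closed I x-y∈I u-v∈I)
        where
        eq : (x - y) + (u - v) ≈ (x + u) - (y + v)
        eq = begin
          (x - y) + (u - v)      ≈⟨ S.interchange x (- y) u (- v) ⟩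
          (x + u) + (- y - v)    ≈⟨ +-congˡ (G.⁻¹-∙-comm y v) ⟩
          (x + u) - (y + v)      ∎

      *-congˡᴵ : ∀ x {u v} → u ≈ᴵ v → x * u ≈ᴵ x * v
      *-congˡᴵ x {u} {v} u-v∈I = resp I eq (*-closed I x u-v∈I)
        where
        eq : x * (u - v) ≈ x * u - x * v
        eq = trans (distribˡ x u (- v)) (+-congˡ (sym (R.-‿distribʳ-* x v)))

      *-congᴵ : ∀ {x y u v} → x ≈ᴵ y → u ≈ᴵ v → x * u ≈ᴵ y * v
      *-congᴵ {x} {y} {u} {v} x≈y u≈v =
        transᴵ (*-congˡᴵ x u≈v)
          (transᴵ (≈⇒≈ᴵ (*-comm x v)) (transᴵ (*-congˡᴵ v x≈y) (≈⇒≈ᴵ (*-comm v y))))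

      -‿congᴵ : ∀ {x y} → x ≈ᴵ y → - x ≈ᴵ - y
      -‿congᴵ {x} {y} x≈y =
        transᴵ (≈⇒≈ᴵ (sym (R.-1*x≈-x x)))
          (transᴵ (*-congˡᴵ (- 1#) x≈y) (≈⇒≈ᴵ (R.-1*x≈-x y)))

    -- R/I has the elements of R, with x and y equal when x - y ∈ I.
    quotientRing : CommutativeRing c (c ⊔ ℓ)
    quotientRing = record
      { Carrier = Carrier
      ; _≈_     = _≈ᴵ_
      ; _+_     = _+_
      ; _*_     = _*_
      ; -_      = -_
      ; 0#      = 0#
      ; 1#      = 1#
      ; isCommutativeRing = record
        { isRing = record
          { +-isAbelianGroup = record
            { isGroup = record
              { isMonoid = record
                { isSemigroup = record
                  { isMagma = record
                    { isEquivalence = record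
                      { refl = ≈⇒≈ᴵ refl ; sym = symᴵ ; trans = transᴵ }
                    ; ∙-cong = +-congᴵ
                    }
                  ; assoc = λ x y z → ≈⇒≈ᴵ (+-assoc x y z)
                  }
                ; identity = (λ x → ≈⇒≈ᴵ (+-identityˡ x)) , (λ x → ≈⇒≈ᴵ (+-identityʳ x))
                }
              ; inverse = (λ x → ≈⇒≈ᴵ (-‿inverseˡ x)) , (λ x → ≈⇒≈ᴵ (-‿inverseʳ x))
              ; ⁻¹-cong = -‿congᴵ
              }
            ; comm = λ x y → ≈⇒≈ᴵ (+-comm x y)
            }
          ; *-cong     = *-congᴵ
          ; *-assoc    = λ x y z → ≈⇒≈ᴵ (*-assoc x y z)
          ; *-identity = (λ x → ≈⇒≈ᴵ (*-identityˡ x)) , (λ x → ≈⇒≈ᴵ (*-identityʳ x))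
          ; distrib    = (λ x y z → ≈⇒≈ᴵ (distribˡ x y z)) , (λ x y z → ≈⇒≈ᴵ (distribʳ x y z))
          }
        ; *-comm = λ x y → ≈⇒≈ᴵ (*-comm x y)
        }
      }

{-# OPTIONS --safe #-}

-- An element of Q = R/(pᵐ) that is neither zero nor a unit is pⁱa with p ∤ a and 0 < i < m, and a
-- product vanishes exactly when the exponents add up to at least m.  The exponent depends only on
-- the neighbours of a vertex, and conversely it determines the class of the vertex when 2i < m.
-- Hence Γ_E(Q) is the threshold graph of the exponent with bound m, and it is the interval graph
-- of the intervals [m - i, max(m - i, i)].  If m ≤ 3, the only light exponent (2i < m) is 1, which
-- is that of a single class, so Γ_E(Q) is complete.  If m ≥ 4, then p and p² are not adjacent.
module Submission where

open import Algebra.Bundles using (CommutativeRing)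
open import Algebra.Properties.Semiring.Exp using (_^_)
open import Algebra.Properties.Semiring.Primality using (Prime)
open import Data.Nat.Base using (ℕ; _≤_)
open import Data.Product.Base using (_×_)
open import Relation.Nullary.Negation.Core using (¬_)
open import Defs

import Algebra.Properties.CommutativeSemigroup as CommutativeSemigroupProperties
import Algebra.Properties.Group as GroupProperties
import Algebra.Properties.Monoid.Mult as Mult
import Algebra.Properties.Ring as RingProperties
import Algebra.Properties.Semiring.Divisibility as SemiringDivisibility
import Algebra.Properties.Semiring.Exp as Exp
open import Data.Fin.Base as Fin using ()
open import Data.Nat.Base as ℕ using (zero; suc; z≤n; s≤s; _<_; _∸_; _⊔_)
import Data.Nat.Properties as ℕ
open import Data.Product.Base using (∃-syntax; _,_; proj₁; proj₂)
open import Data.Rational.Base as ℚ using (ℚ; 0ℚ; 1ℚ; ½)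
import Data.Rational.Properties as ℚ
open import Data.Sum.Base using (_⊎_; inj₁; inj₂; [_,_]′)
open import Function.Base using (_∘_)
open import Function.Bundles using (_⇔_; mk⇔; Equivalence)
open import Function.Construct.Identity using (⇔-id)
open import Level as Level using (Level)
open import Relation.Binary.Bundles using (Setoid)
open import Relation.Binary.Definitions using (tri<; tri≈; tri>)
open import Relation.Binary.PropositionalEquality as ≡ using (_≡_)
import Relation.Binary.Reasoning.Setoid as ≈-Reasoning
open import Relation.Nullary.Decidable.Core using (Dec; yes; no; toWitness; decidable-stable)
open import Relation.Nullary.Negation.Core using (contradiction)

open Equivalence using (to; from)

private
  variable
    c e ℓ : Level

-- The natural numbers among the reals

private
  module ℚ× = Mult ℚ.+-0-monoid

constant : ℚ → ℝ
constant q = record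
  { seq    = λ _ → q
  ; cauchy = λ ε ε>0 → 0 , λ _ _ _ _ →
      ≡.subst (λ d → ℚ.∣ d ∣ ℚ.< ε) (≡.sym (ℚ.+-inverseʳ q)) ε>0
  }

constant-mono-≤ : ∀ {q r} → q ℚ.≤ r → constant q ≤ᵣ constant r
constant-mono-≤ {q} {r} q≤r ε ε>0 = 0 , λ _ _ →
  ℚ.≤-trans q≤r (≡.subst (ℚ._≤ r ℚ.+ ε) (ℚ.+-identityʳ r) (ℚ.+-monoʳ-≤ r (ℚ.<⇒≤ ε>0)))

-- Encoded as the `n`-fold sum of `1ℚ`, so that additivity is an instance of `×-homo-+`.
ℕ→ℚ : ℕ → ℚ
ℕ→ℚ n = n ℚ×.× 1ℚ

private
  0≤1ℚ : 0ℚ ℚ.≤ 1ℚ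
  0≤1ℚ = toWitness {a? = 0ℚ ℚ.≤? 1ℚ} _

ℕ→ℚ-mono-≤ : ∀ {i j} → i ≤ j → ℕ→ℚ i ℚ.≤ ℕ→ℚ j
ℕ→ℚ-mono-≤ {j = zero}  z≤n       = ℚ.≤-refl
ℕ→ℚ-mono-≤ {j = suc j} z≤n       = ℚ.+-mono-≤ 0≤1ℚ (ℕ→ℚ-mono-≤ {j = j} z≤n)
ℕ→ℚ-mono-≤             (s≤s i≤j) = ℚ.+-monoʳ-≤ 1ℚ (ℕ→ℚ-mono-≤ i≤j)

ℕ→ℝ : ℕ → ℝ
ℕ→ℝ n = constant (ℕ→ℚ n)

ℕ→ℝ-mono-≤ : ∀ {i j} → i ≤ j → ℕ→ℝ i ≤ᵣ ℕ→ℝ j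
ℕ→ℝ-mono-≤ i≤j = constant-mono-≤ (ℕ→ℚ-mono-≤ i≤j)

ℕ→ℝ-cong : ∀ {i j} → i ≡ j → ℕ→ℝ i ≈ᵣ ℕ→ℝ j
ℕ→ℝ-cong i≡j = ℕ→ℝ-mono-≤ (ℕ.≤-reflexive i≡j) , ℕ→ℝ-mono-≤ (ℕ.≤-reflexive (≡.sym i≡j))

-- Distinct naturals are at least 1 apart, so the tolerance `½` already refutes `j < i`: it would
-- give `i ≤ j + ½ < j + 1 ≤ i`.
ℕ→ℝ-cancel-≤ : ∀ {i j} → ℕ→ℝ i ≤ᵣ ℕ→ℝ j → i ≤ j
ℕ→ℝ-cancel-≤ {i} {j} i≤ᵣj = ℕ.≮⇒≥ λ j<i → ℚ.<-irrefl ≡.refl (begin-strict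
  ℕ→ℚ i           ≤⟨ proj₂ (i≤ᵣj ½ (toWitness {a? = 0ℚ ℚ.<? ½} _)) _ ℕ.≤-refl ⟩
  ℕ→ℚ j ℚ.+ ½     <⟨ ℚ.+-monoʳ-< (ℕ→ℚ j) (toWitness {a? = ½ ℚ.<? 1ℚ} _) ⟩
  ℕ→ℚ j ℚ.+ 1ℚ    ≡⟨ ℚ.+-comm (ℕ→ℚ j) 1ℚ ⟩
  ℕ→ℚ (suc j)     ≤⟨ ℕ→ℚ-mono-≤ j<i ⟩
  ℕ→ℚ i           ∎)
  where open ℚ.≤-Reasoning

ℕ→ℝ-homo-+ : ∀ i j → ℕ→ℝ (i ℕ.+ j) ≈ᵣ ℕ→ℝ i +ᵣ ℕ→ℝ j
ℕ→ℝ-homo-+ i j = constant-mono-≤ (ℚ.≤-reflexive eq) , constant-mono-≤ (ℚ.≤-reflexive (≡.sym eq))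
  where eq = ℚ×.×-homo-+ 1ℚ i j

-- Threshold graphs with natural weights

-- Two intervals meet when each left end is at most the other right end. If `i + j < m`, then
-- `m ∸ i` exceeds `j`, so it can only be bounded by `m ∸ j`; by symmetry `i ≡ j`, the case that the
-- hypothesis excludes.
intervals-meet⇔ : ∀ {m i j} → i ≤ m → j ≤ m → (i ≡ j → m ≤ i ℕ.+ j) →
  (m ∸ i ≤ (m ∸ j) ⊔ j × m ∸ j ≤ (m ∸ i) ⊔ i) ⇔ m ≤ i ℕ.+ j
intervals-meet⇔ {m} {i} {j} i≤m j≤m i≡j⇒heavy = mk⇔
  (λ (l , r) → ℕ.≮⇒≥ λ i+j<m →
    let j≤i = ℕ.∸-cancelʳ-≤ j≤m (meet⇒≤ {i} {j} i+j<m l)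
        i≤j = ℕ.∸-cancelʳ-≤ i≤m (meet⇒≤ {j} {i} (≡.subst (_< m) (ℕ.+-comm i j) i+j<m) r)
    in ℕ.<⇒≱ i+j<m (i≡j⇒heavy (ℕ.≤-antisym i≤j j≤i)))
  (λ m≤i+j →
      ℕ.≤-trans (ℕ.m≤n+o⇒m∸n≤o m i m≤i+j) (ℕ.m≤n⊔m (m ∸ j) j)
    , ℕ.≤-trans (ℕ.m≤n+o⇒m∸n≤o m j (≡.subst (m ≤_) (ℕ.+-comm i j) m≤i+j)) (ℕ.m≤n⊔m (m ∸ i) i))
  where
  meet⇒≤ : ∀ {i j} → i ℕ.+ j < m → m ∸ i ≤ (m ∸ j) ⊔ j → m ∸ i ≤ m ∸ j
  meet⇒≤ {i} {j} i+j<m m∸i≤ with ℕ.⊔-sel (m ∸ j) j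
  ... | inj₁ eq = ≡.subst (m ∸ i ≤_) eq m∸i≤
  ... | inj₂ eq = contradiction
    (ℕ.≤-trans (ℕ.m≤n+m∸n m i) (ℕ.+-monoʳ-≤ i (≡.subst (m ∸ i ≤_) eq m∸i≤))) (ℕ.<⇒≱ i+j<m)

module _ {V : Setoid c e} (G : GraphOn V) where
  open Setoid V using (_≈_; _≉_) renaming (Carrier to Vertex)
  open GraphOn G

  -- Vertices of equal weight get the same interval and hence meet, so the interval model needs
  -- `same-weight⇒≤+`. The bound `weight≤` allows truncated subtraction from `m` to be cancelled.
  record HasNaturalWeights (m : ℕ) : Set (c Level.⊔ e) where
    field
      weight         : Vertex → ℕ
      weight≤        : ∀ v → weight v ≤ m
      weight-cong    : ∀ {v w} → v ≈ w → weight v ≡ weight w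
      adj⇔           : ∀ v w → v ≉ w → Adj v w ⇔ m ≤ weight v ℕ.+ weight w
      same-weight⇒≤+ : ∀ v w → v ≉ w → weight v ≡ weight w → m ≤ weight v ℕ.+ weight w

    isThresholdGraph : IsThresholdGraph G
    isThresholdGraph = record
      { α         = record { to = ℕ→ℝ ∘ weight ; cong = ℕ→ℝ-cong ∘ weight-cong }
      ; S         = ℕ→ℝ m
      ; adj⇔S≤α+α = λ v w v≉w →
          let i = weight v ; j = weight w ; (≤₁ , ≤₂) = ℕ→ℝ-homo-+ i j in mk⇔
          (λ a → ≤ᵣ-trans {ℕ→ℝ m} {ℕ→ℝ (i ℕ.+ j)} {ℕ→ℝ i +ᵣ ℕ→ℝ j}
                   (ℕ→ℝ-mono-≤ (to (adj⇔ v w v≉w) a)) ≤₁)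
          (λ S≤ → from (adj⇔ v w v≉w) (ℕ→ℝ-cancel-≤
                   (≤ᵣ-trans {ℕ→ℝ m} {ℕ→ℝ i +ᵣ ℕ→ℝ j} {ℕ→ℝ (i ℕ.+ j)} S≤ ≤₂)))
      }

    isIntervalGraph : IsIntervalGraph G
    isIntervalGraph = record
      { lo       = record { to = ℕ→ℝ ∘ left  ; cong = ℕ→ℝ-cong ∘ ≡.cong (m ∸_) ∘ weight-cong }
      ; hi       = record
          { to   = ℕ→ℝ ∘ right
          ; cong = ℕ→ℝ-cong ∘ ≡.cong (λ i → (m ∸ i) ⊔ i) ∘ weight-cong
          }
      ; lo≤hi    = λ v → ℕ→ℝ-mono-≤ (left≤right v)
      ; adj⇔meet = λ v w v≉w →
          let meet⇔ = intervals-meet⇔ (weight≤ v) (weight≤ w) (same-weight⇒≤+ v w v≉w) in mk⇔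
          (λ a → let (l , r) = from meet⇔ (to (adj⇔ v w v≉w) a) in
              -- The larger left end is the common point.
              ℕ→ℝ (left v ⊔ left w)
            , (ℕ→ℝ-mono-≤ (ℕ.m≤m⊔n (left v) (left w))
              , ℕ→ℝ-mono-≤ (ℕ.⊔-lub (left≤right v) r))
            , (ℕ→ℝ-mono-≤ (ℕ.m≤n⊔m (left v) (left w))
              , ℕ→ℝ-mono-≤ (ℕ.⊔-lub l (left≤right w))))
          (λ (x , (lv≤x , x≤rv) , (lw≤x , x≤rw)) → from (adj⇔ v w v≉w) (to meet⇔
            ( ℕ→ℝ-cancel-≤ (≤ᵣ-trans {ℕ→ℝ (left v)} {x} {ℕ→ℝ (right w)} lv≤x x≤rw)
            , ℕ→ℝ-cancel-≤ (≤ᵣ-trans {ℕ→ℝ (left w)} {x} {ℕ→ℝ (right v)} lw≤x x≤rv))))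
      }
      where
      left right : Vertex → ℕ
      left v  = m ∸ weight v
      right v = (m ∸ weight v) ⊔ weight v

      left≤right : ∀ v → left v ≤ right v
      left≤right v = ℕ.m≤m⊔n (left v) (weight v)

  -- Complete graphs and the values 0 and 1

  IsComplete : Set (c Level.⊔ e)
  IsComplete = ∀ v w → v ≉ w → Adj v w

  module _ {p} (P : GraphOn V → Set p) where

    complete⇒minimum≡0 : IsComplete → IsMinimum (IntersectionOf P G) 0
    complete⇒minimum≡0 complete =
      ((λ ()) , (λ ()) , λ v w v≉w → mk⇔ (λ _ ()) (λ _ → complete v w v≉w)) , λ _ _ → z≤n

    -- The graph itself serves as the single factor, and the empty intersection would make it
    -- complete.
    ¬complete⇒minimum≡1 : ¬ IsComplete → P G → IsMinimum (IntersectionOf P G) 1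
    ¬complete⇒minimum≡1 ¬complete PG =
        ((λ _ → G) , (λ _ → PG) , λ v w v≉w → mk⇔ (λ a _ → a) (λ a → a Fin.zero))
      , λ where
          zero    (_ , _ , E≡⋂) → contradiction (λ v w v≉w → from (E≡⋂ v w v≉w) (λ ())) ¬complete
          (suc d) _             → s≤s z≤n

-- Adjacency in the reduced graph

module _ {V : Setoid c e} (G : GraphOn V) where
  open GraphOn

  -- Equivalent vertices have the same neighbours, so the representatives can be exchanged one end
  -- of the edge at a time.
  reducedAdj⇔ : ∀ u v → Adj (reducedGraph G) u v ⇔ Adj G u v
  reducedAdj⇔ u v = mk⇔
    (λ (u′ , v′ , u′~u , v′~v , a) →
      adj-sym G (to (v′~v u) (adj-sym G (to (u′~u v′) a))))
    (λ a → u , v , (λ _ → ⇔-id _) , (λ _ → ⇔-id _) , a)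

-- Valuations

module _ (R : CommutativeRing c ℓ) where
  open CommutativeRing R

  -- {x | x = 0 or P} is generated by 0 or by a non-zero element, according to whether P fails.
  principal⇒dec : IsPrincipalIdealDomain R → (P : Set (c Level.⊔ ℓ)) → Dec P
  principal⇒dec pid P = decide (from (member⇔ a) (1# , *-identityˡ a))
    where
    open SemiringDivisibility semiring using (_,_)
    open IsPrincipalIdealDomain pid

    ideal : Ideal R
    ideal = record
      { Member   = λ x → x ≈ 0# ⊎ P
      ; resp     = λ x≈y → [ inj₁ ∘ trans (sym x≈y) , inj₂ ]′
      ; 0∈       = inj₁ refl
      ; +-closed = λ where
          (inj₁ x≈0) (inj₁ y≈0) → inj₁ (trans (+-cong x≈0 y≈0) (+-identityˡ 0#))
          (inj₁ _)   (inj₂ P)   → inj₂ P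
          (inj₂ P)   _          → inj₂ P
      ; *-closed = λ r → [ (λ x≈0 → inj₁ (trans (*-congˡ x≈0) (zeroʳ r))) , inj₂ ]′
      }

    a       = proj₁ (principal ideal)
    member⇔ = proj₂ (principal ideal)

    decide : a ≈ 0# ⊎ P → Dec P
    decide (inj₂ P)   = yes P
    decide (inj₁ a≈0) = no λ P →
      let (r , ra≈1) = to (member⇔ 1#) (inj₂ P) in
      1≉0 (trans (sym ra≈1) (trans (*-congˡ a≈0) (zeroʳ r)))

  module Valuation
    (noZeroDivisor : ∀ x y → x * y ≈ 0# → x ≈ 0# ⊎ y ≈ 0#)
    {p : Carrier} (prime : Prime semiring p)
    where

    open SemiringDivisibility semiring using (_∣_; _∤_; _,_; ∣ʳ-respʳ-≈)
    open Exp semiring using (^-homo-*)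
    open GroupProperties +-group using (x∙y⁻¹≈ε⇒x≈y; x≈y⇒x∙y⁻¹≈ε)
    open CommutativeSemigroupProperties *-commutativeSemigroup using (interchange; x∙yz≈y∙xz)
    open RingProperties ring using (-‿distribʳ-*)
    open ≈-Reasoning setoid

    open Prime semiring prime

    infixr 8 p^_
    p^_ : ℕ → Carrier
    p^ k = _^_ semiring p k

    -- The `p`-adic valuation as a relation. By `p^∣⇔≤` the exponent is unique, and zero has none.
    record HasValuation (k : ℕ) (x : Carrier) : Set (c Level.⊔ ℓ) where
      constructor hasValuation
      field
        {cofactor} : Carrier
        p∤cofactor : p ∤ cofactor
        equality   : p^ k * cofactor ≈ x

    *-cancelˡ-p : ∀ {x y} → p * x ≈ p * y → x ≈ y
    *-cancelˡ-p {x} {y} px≈py with noZeroDivisor p (x - y) (begin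
      p * (x - y)        ≈⟨ distribˡ p x (- y) ⟩
      p * x + p * - y    ≈⟨ +-congˡ (-‿distribʳ-* p y) ⟨
      p * x - p * y      ≈⟨ x≈y⇒x∙y⁻¹≈ε px≈py ⟩
      0#                 ∎)
    ... | inj₁ p≈0   = contradiction p≈0 p≉0
    ... | inj₂ x-y≈0 = x∙y⁻¹≈ε⇒x≈y x y x-y≈0

    *-hasValuation : ∀ {i j x y} → HasValuation i x → HasValuation j y →
      HasValuation (i ℕ.+ j) (x * y)
    *-hasValuation {i} {j} {x} {y} (hasValuation {a} p∤a pⁱa≈x) (hasValuation {b} p∤b pʲb≈y) =
      -- Primality of `p` keeps the product of the cofactors prime to `p`.
      hasValuation ([ p∤a , p∤b ]′ ∘ split-∣) (begin
      p^ (i ℕ.+ j) * (a * b)      ≈⟨ *-congʳ (^-homo-* p i j) ⟩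
      p^ i * p^ j * (a * b)       ≈⟨ interchange (p^ i) (p^ j) a b ⟩
      p^ i * a * (p^ j * b)       ≈⟨ *-cong pⁱa≈x pʲb≈y ⟩
      x * y                       ∎)

    p^∣⇔≤ : ∀ {m k x} → HasValuation k x → p^ m ∣ x ⇔ m ≤ k
    p^∣⇔≤ (hasValuation {a} p∤a pᵏa≈x) = mk⇔
      (λ (r , rpᵐ≈x) → p^∣⇒≤ _ _ p∤a (r , trans rpᵐ≈x (sym pᵏa≈x)))
      (λ m≤k → ∣ʳ-respʳ-≈ pᵏa≈x (≤⇒p^∣ m≤k a))
      where
      p^∣⇒≤ : ∀ m k {a} → p ∤ a → p^ m ∣ p^ k * a → m ≤ k
      p^∣⇒≤ zero    k       p∤a _            = z≤n
      -- With no factor `p` left on the right, `p` would divide the cofactor.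
      p^∣⇒≤ (suc m) zero    {a} p∤a (r , eq) = contradiction (r * p^ m , (begin
        r * p^ m * p      ≈⟨ *-assoc r (p^ m) p ⟩
        r * (p^ m * p)    ≈⟨ *-congˡ (*-comm (p^ m) p) ⟩
        r * p^ suc m      ≈⟨ eq ⟩
        1# * a            ≈⟨ *-identityˡ a ⟩
        a                 ∎)) p∤a
      p^∣⇒≤ (suc m) (suc k) {a} p∤a (r , eq) = s≤s (p^∣⇒≤ m k p∤a (r , *-cancelˡ-p (begin
        p * (r * p^ m)    ≈⟨ x∙yz≈y∙xz p r (p^ m) ⟩
        r * p^ suc m      ≈⟨ eq ⟩
        p * p^ k * a      ≈⟨ *-assoc p (p^ k) a ⟩
        p * (p^ k * a)    ∎)))

      ≤⇒p^∣ : ∀ {m k} → m ≤ k → ∀ a → p^ m ∣ p^ k * a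
      ≤⇒p^∣ {m} {k} m≤k a = p^ (k ∸ m) * a , (begin
        p^ (k ∸ m) * a * p^ m      ≈⟨ *-comm _ (p^ m) ⟩
        p^ m * (p^ (k ∸ m) * a)    ≈⟨ *-assoc (p^ m) (p^ (k ∸ m)) a ⟨
        p^ m * p^ (k ∸ m) * a      ≈⟨ *-congʳ (^-homo-* p m (k ∸ m)) ⟨
        p^ (m ℕ.+ (k ∸ m)) * a     ≡⟨ ≡.cong (λ n → p^ n * a) (ℕ.m+[n∸m]≡n m≤k) ⟩
        p^ k * a                   ∎)

    -- Division by `p` is repeated while possible; since `p^ m` does not divide `x`, it must stop
    -- within `m` rounds, which makes `m` the measure of the recursion.
    valuation : (∀ x → Dec (p ∣ x)) → ∀ m x → p^ m ∤ x → ∃[ k ] HasValuation k x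
    valuation p∣? zero    x 1∤x = contradiction (x , *-identityʳ x) 1∤x
    valuation p∣? (suc m) x p^∤x with p∣? x
    ... | no p∤x         = 0 , hasValuation p∤x (*-identityˡ x)
    ... | yes (q , qp≈x) =
      let (k , hasValuation {a} p∤a pᵏa≈q) = valuation p∣? m q λ (r , rpᵐ≈q) → p^∤x (r , (begin
            r * (p * p^ m)    ≈⟨ *-congˡ (*-comm p (p^ m)) ⟩
            r * (p^ m * p)    ≈⟨ *-assoc r (p^ m) p ⟨
            r * p^ m * p      ≈⟨ *-congʳ rpᵐ≈q ⟩
            q * p             ≈⟨ qp≈x ⟩
            x                 ∎))
      in suc k , hasValuation p∤a (begin
        p * p^ k * a          ≈⟨ *-assoc p (p^ k) a ⟩
        p * (p^ k * a)        ≈⟨ *-congˡ pᵏa≈q ⟩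
        p * q                 ≈⟨ *-comm p q ⟩
        q * p                 ≈⟨ qp≈x ⟩
        x                     ∎)

  -- The zero divisor graph of R/(pᵐ)

  module ZeroDivisorGraph
    (pid : IsPrincipalIdealDomain R)
    {p : Carrier} (prime : Prime semiring p)
    {g u : Carrier} (m : ℕ) (unit : IsUnit R u) (g≈upᵐ : g ≈ u * _^_ semiring p m)
    where

    open IsPrincipalIdealDomain pid using (noZeroDivisor)
    open Valuation noZeroDivisor prime
    open Prime semiring prime
    open SemiringDivisibility semiring using (_∣_; _∤_; _,_; ∣ʳ-trans; ∣ʳ-respʳ-≈)

    private
      module Q = CommutativeRing (quotientRing R (principalIdeal R g))
      Γ  = zeroDivisorGraph (quotientRing R (principalIdeal R g))
      ΓE = reducedZeroDivisorGraph (quotientRing R (principalIdeal R g))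
      module Γ  = GraphOn Γ
      module ΓE = GraphOn ΓE
      Vertex = Setoid.Carrier (zeroDivisorVertices (quotientRing R (principalIdeal R g)))

      infix 4 _~_
      _~_ : Vertex → Vertex → Set (c Level.⊔ ℓ)
      _~_ = SameNeighbours Γ

      dec : (P : Set (c Level.⊔ ℓ)) → Dec P
      dec = principal⇒dec pid

      ⌊_⌋ : Vertex → Carrier
      ⌊_⌋ = proj₁

    ≈⇒≈Q : ∀ {x y} → x ≈ y → x Q.≈ y
    ≈⇒≈Q {x} {y} x≈y = 0# , trans (zeroˡ g) (sym (GroupProperties.x≈y⇒x∙y⁻¹≈ε +-group x≈y))

    -- As `u` is a unit, `g` and `p^ m` divide each other.
    ≈0⇔p^∣ : ∀ x → x Q.≈ 0# ⇔ p^ m ∣ x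
    ≈0⇔p^∣ x = mk⇔
      (λ g∣x-0 → ∣ʳ-trans p^∣g (∣ʳ-respʳ-≈ x-0≈x g∣x-0))
      (λ p^∣x → ∣ʳ-respʳ-≈ (sym x-0≈x) (∣ʳ-trans g∣p^ p^∣x))
      where
      open ≈-Reasoning setoid
      x-0≈x : x - 0# ≈ x
      x-0≈x = trans (+-congˡ (GroupProperties.ε⁻¹≈ε +-group)) (+-identityʳ x)

      p^∣g : p^ m ∣ g
      p^∣g = u , sym g≈upᵐ

      g∣p^ : g ∣ p^ m
      g∣p^ = let (v , vu≈1) = unit in v , (begin
        v * g             ≈⟨ *-congˡ g≈upᵐ ⟩
        v * (u * p^ m)    ≈⟨ *-assoc v u (p^ m) ⟨
        v * u * p^ m      ≈⟨ *-congʳ vu≈1 ⟩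
        1# * p^ m         ≈⟨ *-identityˡ (p^ m) ⟩
        p^ m              ∎)

    ≈0⇔≤ : ∀ {k x} → HasValuation k x → x Q.≈ 0# ⇔ m ≤ k
    ≈0⇔≤ {x = x} v = mk⇔ (to (p^∣⇔≤ v) ∘ to (≈0⇔p^∣ x)) (from (≈0⇔p^∣ x) ∘ from (p^∣⇔≤ v))

    *≈0⇔≤ : ∀ {i j x y} → HasValuation i x → HasValuation j y → x * y Q.≈ 0# ⇔ m ≤ i ℕ.+ j
    *≈0⇔≤ v w = ≈0⇔≤ (*-hasValuation v w)

    p^_·_ : ∀ k {a} → p ∤ a → HasValuation k (p^ k * a)
    p^ k · p∤a = hasValuation p∤a refl

    ∃valuation : ∀ {x} → x Q.≉ 0# → ∃[ k ] (HasValuation k x × k < m)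
    ∃valuation {x} x≉0 =
      let (k , v) = valuation (λ y → dec (p ∣ y)) m x (x≉0 ∘ from (≈0⇔p^∣ x))
      in k , v , ℕ.≰⇒> (x≉0 ∘ from (≈0⇔≤ v))

    vertexValuation : (v : Vertex) → ∃[ k ] (HasValuation k ⌊ v ⌋ × 0 < k × k < m)
    vertexValuation (x , (s , s≉0 , xs≈0) , x≉0) =
      let (i , v , i<m) = ∃valuation x≉0
          (j , w , j<m) = ∃valuation s≉0
      -- The annihilator has exponent `j < m`, yet `m ≤ i + j`; hence `i` is positive.
      in i , v , ℕ.+-cancelʳ-< j 0 i (ℕ.<-≤-trans j<m (to (*≈0⇔≤ v w) xs≈0)) , i<m

    val : Vertex → ℕ
    val = proj₁ ∘ vertexValuation

    hasVal : ∀ v → HasValuation (val v) ⌊ v ⌋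
    hasVal = proj₁ ∘ proj₂ ∘ vertexValuation

    1≤val : ∀ v → 1 ≤ val v
    1≤val = proj₁ ∘ proj₂ ∘ proj₂ ∘ vertexValuation

    val<m : ∀ v → val v < m
    val<m = proj₂ ∘ proj₂ ∘ proj₂ ∘ vertexValuation

    primePower : ∀ k → 1 ≤ k → k < m → Vertex
    primePower k@(suc _) _ k<m =
        p^ k * 1#
      -- The annihilator is the complementary power; it is non-zero in the quotient because `k` is
      -- positive.
      , (p^ (m ∸ k) * 1# , ℕ.<⇒≱ (ℕ.∸-monoʳ-< (s≤s z≤n) (ℕ.<⇒≤ k<m)) ∘ to (≈0⇔≤ (p^ (m ∸ k) · p∤1))
        , from (*≈0⇔≤ (p^ k · p∤1) (p^ (m ∸ k) · p∤1)) (ℕ.≤-reflexive (≡.sym (ℕ.m+[n∸m]≡n (ℕ.<⇒≤ k<m)))))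
      , ℕ.<⇒≱ k<m ∘ to (≈0⇔≤ (p^ k · p∤1))

    -- Here `z` is a neighbour of `w` but not of `v`. It is a vertex, being annihilated by `w` and
    -- non-zero because its product with `v` is.
    separated⇒≁ : ∀ (v w : Vertex) {z} →
      z Q.≉ ⌊ w ⌋ → ⌊ w ⌋ * z Q.≈ 0# → ⌊ v ⌋ * z Q.≉ 0# → ¬ v ~ w
    separated⇒≁ v w@(y , _ , y≉0) {z} z≉y yz≈0 xz≉0 v~w =
      xz≉0 (proj₂ (from (v~w zᵥ) (z≉y ∘ Q.sym , yz≈0)))
      where
      zᵥ : Vertex
      zᵥ = z , (y , y≉0 , Q.trans (Q.*-comm z y) yz≈0)
             , λ z≈0 → xz≉0 (Q.trans (Q.*-congˡ z≈0) (Q.zeroʳ _))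

    -- The multiples pᵏ and pᵏ(1 + p), where k = m - j, annihilate w but not v, and they are distinct
    -- in Q because k + 1 < m.  So one of them differs from w and separates the two vertices.
    valuation<⇒≁ : ∀ v w {i j} → HasValuation i ⌊ v ⌋ → HasValuation j ⌊ w ⌋ →
      1 ≤ i → i < j → j < m → ¬ v ~ w
    valuation<⇒≁ v w {i} {j} hv hw 1≤i i<j j<m v~w =
      ℕ.<⇒≱ 1+k<m (to (≈0⇔≤ (*-hasValuation (p^ k · p∤1) hasVal-p)) p^k*p≈0)
      where
      k = m ∸ j

      1+k<m : k ℕ.+ 1 < m
      1+k<m = begin-strict
        -- From `1 ≤ i < j` follows `j ≥ 2`.
        k ℕ.+ 1    <⟨ ℕ.+-monoʳ-< k (ℕ.≤-<-trans 1≤i i<j) ⟩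
        k ℕ.+ j    ≡⟨ ℕ.m∸n+n≡m (ℕ.<⇒≤ j<m) ⟩
        m          ∎
        where open ℕ.≤-Reasoning

      i+k<m : i ℕ.+ k < m
      i+k<m = ≡.subst (i ℕ.+ k <_) (ℕ.m+[n∸m]≡n (ℕ.<⇒≤ j<m)) (ℕ.+-monoˡ-< k i<j)

      hasVal-p : HasValuation 1 p
      hasVal-p = hasValuation p∤1 (trans (*-identityʳ _) (*-identityʳ p))

      p∤1+p : p ∤ 1# + p
      p∤1+p (r , rp≈1+p) = p∤1 (r - 1# , (begin
        (r - 1#) * p      ≈⟨ [y-z]x≈yx-zx p r 1# ⟩
        r * p - 1# * p    ≈⟨ +-cong rp≈1+p (-‿cong (*-identityˡ p)) ⟩
        1# + p - p        ≈⟨ //-rightDividesʳ p 1# ⟩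
        1#                ∎))
        where
        open ≈-Reasoning setoid
        open RingProperties ring using ([y-z]x≈yx-zx)
        open GroupProperties +-group using (//-rightDividesʳ)

      coincides : ∀ {a} → p ∤ a → p^ k * a Q.≈ ⌊ w ⌋
      coincides p∤a = decidable-stable (dec _) λ z≉w → separated⇒≁ v w z≉w
        (from (*≈0⇔≤ hw (p^ k · p∤a)) (ℕ.≤-reflexive (≡.sym (ℕ.m+[n∸m]≡n (ℕ.<⇒≤ j<m)))))
        (ℕ.<⇒≱ i+k<m ∘ to (*≈0⇔≤ hv (p^ k · p∤a)))
        v~w

      p^k*p≈0 : p^ k * 1# * p Q.≈ 0#
      p^k*p≈0 = GroupProperties.identityʳ-unique Q.+-group (p^ k * 1#) (p^ k * 1# * p) (begin
        p^ k * 1# + p^ k * 1# * p    ≈⟨ ≈⇒≈Q (+-congˡ (*-congʳ (*-identityʳ (p^ k)))) ⟩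
        p^ k * 1# + p^ k * p         ≈⟨ Q.distribˡ (p^ k) 1# p ⟨
        p^ k * (1# + p)              ≈⟨ coincides p∤1+p ⟩
        ⌊ w ⌋                        ≈⟨ coincides p∤1 ⟨
        p^ k * 1#                    ∎)
        where open ≈-Reasoning Q.setoid

    val-cong : ∀ {v w} → v ~ w → val v ≡ val w
    val-cong {v} {w} v~w with ℕ.<-cmp (val v) (val w)
    ... | tri≈ _ eq _ = eq
    ... | tri< lt _ _ = contradiction v~w (valuation<⇒≁ v w (hasVal v) (hasVal w) (1≤val v) lt (val<m w))
    ... | tri> _ _ gt = contradiction (Setoid.sym (reducedVertices Γ) {v} {w} v~w)
      (valuation<⇒≁ w v (hasVal w) (hasVal v) (1≤val w) gt (val<m v))

    -- Whether a product with `z` vanishes depends only on the exponents. Adjacency also asks that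
    -- `z` differ from the vertex; lightness ensures this, for if `z` were `w` then `vz = 0` would
    -- read `vw = 0`.
    light⇒~ : ∀ v w → val v ≡ val w → ¬ m ≤ val v ℕ.+ val w → v ~ w
    light⇒~ v w eq light z = mk⇔ (neighbour v w eq light)
      (neighbour w v (≡.sym eq) (light ∘ ≡.subst (m ≤_) (ℕ.+-comm (val w) (val v))))
      where
      neighbour : ∀ v w → val v ≡ val w → ¬ m ≤ val v ℕ.+ val w → Γ.Adj v z → Γ.Adj w z
      neighbour v w eq light (v≉z , vz≈0) =
          (λ w≈z → light (to (*≈0⇔≤ (hasVal v) (hasVal w)) (Q.trans (Q.*-congˡ w≈z) vz≈0)))
        , from (*≈0⇔≤ (hasVal w) (hasVal z))
            (≡.subst (λ k → m ≤ k ℕ.+ val z) eq (to (*≈0⇔≤ (hasVal v) (hasVal z)) vz≈0))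

    adj⇔ : ∀ v w → ¬ v ~ w → ΓE.Adj v w ⇔ m ≤ val v ℕ.+ val w
    adj⇔ v w v≁w = mk⇔
      (to (*≈0⇔≤ (hasVal v) (hasVal w)) ∘ proj₂ ∘ to (reducedAdj⇔ Γ v w))
      (λ m≤ → from (reducedAdj⇔ Γ v w)
        -- Elements equal in the quotient have the same neighbours, so inequivalent vertices are
        -- distinct elements.
        ( (λ v≈w → v≁w λ z → mk⇔ (proj₂ Γ.adj-resp {z} {v} {w} v≈w)
                                 (proj₂ Γ.adj-resp {z} {w} {v} (Q.sym v≈w)))
        , from (*≈0⇔≤ (hasVal v) (hasVal w)) m≤))

    naturalWeights : HasNaturalWeights ΓE m
    naturalWeights = record
      { weight         = val
      ; weight≤        = ℕ.<⇒≤ ∘ val<m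
      ; weight-cong    = λ {v} {w} → val-cong {v} {w}
      ; adj⇔           = adj⇔
      ; same-weight⇒≤+ = λ v w v≁w eq →
          decidable-stable (m ℕ.≤? val v ℕ.+ val w) (v≁w ∘ light⇒~ v w eq)
      }

    complete : m ≤ 3 → IsComplete ΓE
    complete m≤3 v w v≁w = from (adj⇔ v w v≁w)
      (decidable-stable (m ℕ.≤? val v ℕ.+ val w) λ light →
        -- A light pair has exponent sum at most 2, so both exponents are 1 and the two classes
        -- coincide.
        v≁w (light⇒~ v w (≡.trans (light⇒≡1 (1≤val v) (1≤val w) light)
          (≡.sym (light⇒≡1 (1≤val w) (1≤val v)
            (light ∘ ≡.subst (m ≤_) (ℕ.+-comm (val w) (val v)))))) light))
      where
      light⇒≡1 : ∀ {i j} → 1 ≤ i → 1 ≤ j → ¬ m ≤ i ℕ.+ j → i ≡ 1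
      light⇒≡1 {i} {j} 1≤i 1≤j light = ℕ.≤-antisym (ℕ.+-cancelʳ-≤ 1 i 1 (begin
        i ℕ.+ 1    ≤⟨ ℕ.+-monoʳ-≤ i 1≤j ⟩
        i ℕ.+ j    ≤⟨ ℕ.s≤s⁻¹ (ℕ.<-≤-trans (ℕ.≰⇒> light) m≤3) ⟩
        2          ∎)) 1≤i
        where open ℕ.≤-Reasoning

    ¬complete : 4 ≤ m → ¬ IsComplete ΓE
    ¬complete 4≤m complete =
      -- Adjacency of `p` and `p²` would require `m ≤ 1 + 2`.
      ℕ.<⇒≱ 4≤m (to (*≈0⇔≤ (p^ 1 · p∤1) (p^ 2 · p∤1))
        (proj₂ (to (reducedAdj⇔ Γ v w) (complete v w
          (valuation<⇒≁ v w (p^ 1 · p∤1) (p^ 2 · p∤1) 1≤1 (s≤s 1≤1) 2<m)))))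
      where
      1≤1 = ℕ.≤-refl {1}
      2<m : 2 < m
      2<m = ℕ.<⇒≤ 4≤m
      v w : Vertex
      v = primePower 1 1≤1 (ℕ.<⇒≤ 2<m)
      w = primePower 2 (s≤s z≤n) 2<m

lemma78 :
    ∀ {c ℓ} (R : CommutativeRing c ℓ) →
    let open CommutativeRing R in
    IsPrincipalIdealDomain R →
    (g : Carrier) →
    let I   = principalIdeal R g
        Q   = quotientRing R I
        Γ-E = reducedZeroDivisorGraph Q
    in
    IsProper R I →
    ¬ IsPrimeIdeal R I →
    IsFinite (CommutativeRing.setoid Q) →
    (u p₁ : Carrier) (m₁ : ℕ) →
    IsUnit R u →
    Prime semiring p₁ →
    1 ≤ m₁ →
    g ≈ u * _^_ semiring p₁ m₁ →
    (m₁ ≤ 3 → IsThresholdDimension Γ-E 0 × IsBoxicity Γ-E 0) ×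
    (4 ≤ m₁ → IsThresholdDimension Γ-E 1 × IsBoxicity Γ-E 1)
lemma78 R pid g _ _ _ u p₁ m₁ unit prime _ g≈upᵐ =
    (λ m≤3 → complete⇒minimum≡0 ΓE IsThresholdGraph (complete m≤3)
           , complete⇒minimum≡0 ΓE IsIntervalGraph (complete m≤3))
  , (λ 4≤m → ¬complete⇒minimum≡1 ΓE IsThresholdGraph (¬complete 4≤m) (isThresholdGraph naturalWeights)
           , ¬complete⇒minimum≡1 ΓE IsIntervalGraph (¬complete 4≤m) (isIntervalGraph naturalWeights))
  where
  open ZeroDivisorGraph R pid prime m₁ unit g≈upᵐ
  open HasNaturalWeights
  ΓE = reducedZeroDivisorGraph (quotientRing R (principalIdeal R g))
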